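{- For $m,n\ge1$ let $p(m,n)$ be the number of Fibonacci polyominoes with horizontal semiperimeter $m$ and vertical semiperimeter $n$, and let $P(x,y)=\sum_{m,n\geq 1}p(m,n)x^my^n$. Then, as formal power series, \[ P(x,y)=\frac{1 + x - y - 3 x y -(1+x)\sqrt{(1 - y) (1 - y - 4 x y)}}{2x}, \] where the square root denotes the branch (power series) with constant term $1$.
   Context: A Fibonacci polyomino is a (nonempty) polyomino, considered up to translation, that is column-convex (each column is a contiguous segment of unit cells) and such that, reading columns from left to right, the bottom cell of each column lies exactly one unit above the bottom cell of the preceding column. Equivalently, it is given by a sequence of column heights $(h_1,\dots,h_m)$, $m\ge 1$, with $h_i\ge 2$ for $1\le i\le m-1$ and $h_m\ge 1$; column $i$ consists of the cells in column position $i$ and rows $i,i+1,\dots,i+h_i-1$. The horizontal (resp. vertical) semiperimeter of a polyomino is half the number of horizontal (resp. vertical) unit edges on its boundary (a boundary edge is a unit edge belonging to exactly one cell). -}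

module Defs where

open import Data.Fin.Base using (toℕ)
open import Data.Integer.Base as ℤ using (ℤ; +_; 0ℤ; 1ℤ)
import Data.Integer.Properties as ℤₚ
open import Data.List.Base using (List; []; _∷_; _++_; concatMap; filter; length; map; upTo)
open import Data.List.Membership.DecPropositional using (_∈?_)
open import Data.Nat.Base using (ℕ; zero; suc; _+_; _*_; _∸_; _≥_)
open import Data.Nat.Properties using (_≟_)
open import Data.Product.Base using (_×_; _,_)
open import Data.Product.Properties using (≡-dec)
open import Relation.Binary.Definitions using (DecidableEquality)
open import Relation.Binary.PropositionalEquality.Core using (_≡_)

open import Algebra.Properties.CommutativeMonoid.Sum ℤₚ.+-0-commutativeMonoid using (sum⁺-syntax)

-- The cell (c , r) is the unit square [c , c+1] × [r , r+1].
Cell : Set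
Cell = ℕ × ℕ

-- A unit edge, horizontal or vertical, is named by its left, respectively
-- lower, endpoint.
Edge : Set
Edge = ℕ × ℕ

_≟ᵉ_ : DecidableEquality Edge
_≟ᵉ_ = ≡-dec _≟_ _≟_

horizontalEdges : Cell → List Edge
horizontalEdges (c , r) = (c , r) ∷ (c , suc r) ∷ []

verticalEdges : Cell → List Edge
verticalEdges (c , r) = (c , r) ∷ (suc c , r) ∷ []

incidence : (Cell → List Edge) → List Cell → Edge → ℕ
incidence edges cs e = length (filter (λ c → _∈?_ _≟ᵉ_ e (edges c)) cs)

-- For a list of distinct cells, an edge of exactly one cell is listed exactly
-- once by concatMap, so the length of this list is the number of such edges.
boundary : (Cell → List Edge) → List Cell → List Edge
boundary edges cs = filter (λ e → incidence edges cs e ≟ 1) (concatMap edges cs)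

HasHorizontalSemiperimeter : List Cell → ℕ → Set
HasHorizontalSemiperimeter cs m = length (boundary horizontalEdges cs) ≡ 2 * m

HasVerticalSemiperimeter : List Cell → ℕ → Set
HasVerticalSemiperimeter cs n = length (boundary verticalEdges cs) ≡ 2 * n

data IsFibonacci : List ℕ → Set where
  last : ∀ {h} → h ≥ 1 → IsFibonacci (h ∷ [])
  _∷_  : ∀ {h hs} → h ≥ 2 → IsFibonacci hs → IsFibonacci (h ∷ hs)

column : ℕ → ℕ → List Cell
column i h = map (λ k → i , i + k) (upTo h)

columnsFrom : ℕ → List ℕ → List Cell
columnsFrom i []       = []
columnsFrom i (h ∷ hs) = column i h ++ columnsFrom (suc i) hs

cells : List ℕ → List Cell
cells = columnsFrom 1

-- A translation class is represented by its sequence of column heights. The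
-- three proof fields are propositions, so _≡_ on this type is equality of
-- height sequences.
record FibonacciPolyomino (m n : ℕ) : Set where
  field
    heights     : List ℕ
    isFibonacci : IsFibonacci heights
    horizontal  : HasHorizontalSemiperimeter (cells heights) m
    vertical    : HasVerticalSemiperimeter (cells heights) n

-- Formal power series in two variables x and y: F m n is the coefficient of
-- xᵐ yⁿ.
Series : Set
Series = ℕ → ℕ → ℤ

infix  4 _≈_
infixl 6 _⊕_ _⊖_
infixl 7 _⊛_

_≈_ : Series → Series → Set
F ≈ G = ∀ m n → F m n ≡ G m n

_⊕_ _⊖_ _⊛_ : Series → Series → Series
(F ⊕ G) m n = F m n ℤ.+ G m n
(F ⊖ G) m n = F m n ℤ.- G m n
(F ⊛ G) m n = ∑[ i ≤ m ] ∑[ j ≤ n ] (F (toℕ i) (toℕ j) ℤ.* G (m ∸ toℕ i) (n ∸ toℕ j))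

const : ℤ → Series
const a zero zero = a
const a _    _    = 0ℤ

x y : Series
x 1 0 = 1ℤ
x _ _ = 0ℤ
y 0 1 = 1ℤ
y _ _ = 0ℤ

record IsSqrtWithConstantTermOne (S D : Series) : Set where
  field
    square       : S ⊛ S ≈ D
    constantTerm : S 0 0 ≡ 1ℤ

generatingFunction : (ℕ → ℕ → ℕ) → Series
generatingFunction p zero    _       = 0ℤ
generatingFunction p (suc _) zero    = 0ℤ
generatingFunction p (suc m) (suc n) = + p (suc m) (suc n)

{-# OPTIONS --safe #-}
module Submission where

-- The horizontal semiperimeter is the number of columns, and the vertical one is the total rise of
-- the top profile, where a column of height h leaves the profile h − 1 units above the bottom of
-- the next column. Let L k and R k be the generating functions of the sequences with first height
-- ≤ k and > k, weighted by the rise from level k, and H h that of the sequences with first height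
-- h + 1. Then
--   H (h + 1) = x (1 + L (h + 1) + R (h + 1)),  L (k + 1) = L k + H k,  R k = y (H k + R (k + 1)).
-- If c is the Catalan series with c − 1 = y (c − 1) + x y c², these equations are solved by
-- multiples of powers of 1 + x c. They determine the coefficients recursively, and
-- P = R 0 = y ((1 + x) c − 1), while the square root is 1 − y − 2 x y c.

open import Algebra.Bundles using (CommutativeRing; RawRing)
import Algebra.Construct.Pointwise as Pointwise
import Algebra.Morphism.RingMonomorphism as RingMonomorphism
open import Algebra.Morphism.Structures using (module RingMorphisms)
import Algebra.Solver.Ring as RingSolver
open import Algebra.Solver.Ring.AlmostCommutativeRing using (fromCommutativeRing; _-Raw-AlmostCommutative⟶_; Induced-equivalence)
open import Algebra.Structures using (IsCommutativeRing)
open import Data.Bool.Base using (Bool; true; false; not; _∨_; if_then_else_)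
open import Data.Fin.Base using (Fin; zero; suc; toℕ)
open import Data.Integer.Base as ℤ using (ℤ; +_; 0ℤ; 1ℤ)
import Data.Integer.Properties as ℤₚ
open import Data.List.Base using (List; []; _∷_; [_]; _++_; applyUpTo; concatMap; filter; length; lookup; map)
open import Data.List.Membership.Propositional using (_∈_)
open import Data.List.Membership.Propositional.Properties using (∈-++⁺ˡ; ∈-++⁺ʳ; ∈-++⁻; ∈-lookup; ∈-map⁺; ∈-map⁻)
open import Data.List.Membership.Propositional.Properties.WithK using (unique⇒irrelevant)
open import Data.List.Properties using (concatMap-++; filter-++; length-++; length-map; map-upTo; ∷-injectiveˡ; ∷-injectiveʳ)
open import Data.List.Relation.Binary.Disjoint.Propositional using (Disjoint)
open import Data.List.Relation.Unary.All using (All; []; _∷_)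
open import Data.List.Relation.Unary.AllPairs using ([]; _∷_)
open import Data.List.Relation.Unary.Any using (here; there; index)
open import Data.List.Relation.Unary.Any.Properties using (lookup-index)
open import Data.List.Relation.Unary.Unique.Propositional using (Unique)
import Data.List.Relation.Unary.Unique.Propositional.Properties as Unique
open import Data.Maybe.Base using (just; nothing)
open import Data.Nat.Base as ℕ using (ℕ; zero; suc; pred; _∸_; _≤_; _<_; _≥_; _≡ᵇ_; _<ᵇ_; z≤n; s≤s)
import Data.Nat.Properties as ℕₚ
open import Data.Nat.Tactic.RingSolver using (solve-∀)
open import Data.Product.Base using (Σ-syntax; ∃-syntax; _×_; _,_; proj₂)
open import Data.Sum.Base using (_⊎_; inj₁; inj₂)
open import Function.Base using (_∘_; id)
open import Function.Bundles using (_⇔_; mk⇔; _↔_; mk↔ₛ′)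
open import Level using (0ℓ)
open import Relation.Binary.Definitions using (WeaklyDecidable)
open import Relation.Binary.PropositionalEquality using (_≡_; refl; sym; trans; cong; cong₂; subst; module ≡-Reasoning)
open import Relation.Nullary.Decidable using (yes; no; does; does-⇔; _⊎-dec_; dec-false)
open import Relation.Nullary.Negation using (contradiction; ¬_)
open import Relation.Unary using (Pred; Decidable)

-- Formal power series

module PowerSeries {c ℓ} (R : CommutativeRing c ℓ) where
  open CommutativeRing R renaming (refl to ≈-refl; sym to ≈-sym; trans to ≈-trans)
  open import Algebra.Properties.CommutativeMonoid.Sum +-commutativeMonoid using (sum⁺-syntax)
  open import Algebra.Properties.CommutativeSemigroup +-commutativeSemigroup using (interchange)
  open import Relation.Binary.Reasoning.Setoid setoid

  PS : Set c
  PS = ℕ → Carrier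

  infix  4 _≋_
  infixl 7 _·_

  _≋_ : PS → PS → Set ℓ
  f ≋ g = ∀ n → f n ≈ g n

  _·_ : PS → PS → PS
  (f · g) n = ∑[ i ≤ n ] (f (toℕ i) * g (n ∸ toℕ i))

  constant : Carrier → PS
  constant a zero    = a
  constant a (suc _) = 0#

  X : PS
  X zero    = 0#
  X (suc n) = constant 1# n

  ·-cong : ∀ {f f′ g g′} → f ≋ f′ → g ≋ g′ → f · g ≋ f′ · g′
  ·-cong p q zero    = +-congʳ (*-cong (p 0) (q 0))
  ·-cong p q (suc n) = +-cong (*-cong (p 0) (q (suc n))) (·-cong (p ∘ suc) q n)

  ·-zeroˡ : ∀ g n → ((λ _ → 0#) · g) n ≈ 0#
  ·-zeroˡ g zero    = ≈-trans (+-identityʳ _) (zeroˡ _)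
  ·-zeroˡ g (suc n) = ≈-trans (+-cong (zeroˡ _) (·-zeroˡ g n)) (+-identityˡ 0#)

  constant-· : ∀ a g n → (constant a · g) n ≈ a * g n
  constant-· a g zero    = +-identityʳ _
  constant-· a g (suc n) = ≈-trans (+-congˡ (·-zeroˡ g n)) (+-identityʳ _)

  X-·-zero : ∀ g → (X · g) 0 ≈ 0#
  X-·-zero g = ≈-trans (+-identityʳ _) (zeroˡ _)

  X-·-suc : ∀ g n → (X · g) (suc n) ≈ g n
  X-·-suc g n = ≈-trans (+-cong (zeroˡ _) (constant-· 1# g n)) (≈-trans (+-identityˡ _) (*-identityˡ _))

  ·-identityˡ : ∀ g → constant 1# · g ≋ g
  ·-identityˡ g n = ≈-trans (constant-· 1# g n) (*-identityˡ _)

  ·-distribʳ : ∀ h f g → (λ n → f n + g n) · h ≋ (λ n → (f · h) n + (g · h) n)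
  ·-distribʳ h f g zero    = ≈-trans (+-identityʳ _)
    (≈-trans (distribʳ _ _ _) (≈-sym (+-cong (+-identityʳ _) (+-identityʳ _))))
  ·-distribʳ h f g (suc n) = ≈-trans
    (+-cong (distribʳ _ _ _) (·-distribʳ h (f ∘ suc) (g ∘ suc) n)) (interchange _ _ _ _)

  ·-scaleˡ : ∀ a f g n → ((λ k → a * f k) · g) n ≈ a * (f · g) n
  ·-scaleˡ a f g zero    = ≈-trans (+-identityʳ _)
    (≈-trans (*-assoc _ _ _) (*-congˡ (≈-sym (+-identityʳ _))))
  ·-scaleˡ a f g (suc n) = ≈-trans
    (+-cong (*-assoc _ _ _) (·-scaleˡ a (f ∘ suc) g n)) (≈-sym (distribˡ _ _ _))

  -- Shifting `f · g` by one index gives `f 0` times the shift of `g`, plus the product of the shift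
  -- of `f` with `g`. Multiplied by `h`, the second summand falls to the induction hypothesis, and
  -- `f 0` factors out of the rest.
  ·-assoc : ∀ f g h → (f · g) · h ≋ f · (g · h)
  ·-assoc f g h zero    = +-congʳ (begin
    (f 0 * g 0 + 0#) * h 0  ≈⟨ *-congʳ (+-identityʳ _) ⟩
    f 0 * g 0 * h 0         ≈⟨ *-assoc _ _ _ ⟩
    f 0 * (g 0 * h 0)       ≈⟨ *-congˡ (≈-sym (+-identityʳ _)) ⟩
    f 0 * (g 0 * h 0 + 0#)  ∎)
  ·-assoc f g h (suc n) = begin
    (f 0 * g 0 + 0#) * h (suc n) + ((λ k → f 0 * g (suc k) + ((f ∘ suc) · g) k) · h) n
      ≈⟨ +-cong (≈-trans (*-congʳ (+-identityʳ _)) (*-assoc _ _ _)) (·-distribʳ h (λ k → f 0 * g (suc k)) ((f ∘ suc) · g) n) ⟩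
    f 0 * (g 0 * h (suc n)) + (((λ k → f 0 * g (suc k)) · h) n + (((f ∘ suc) · g) · h) n)
      ≈⟨ +-congˡ (+-cong (·-scaleˡ (f 0) (g ∘ suc) h n) (·-assoc (f ∘ suc) g h n)) ⟩
    f 0 * (g 0 * h (suc n)) + (f 0 * ((g ∘ suc) · h) n + ((f ∘ suc) · (g · h)) n)
      ≈⟨ ≈-sym (+-assoc _ _ _) ⟩
    f 0 * (g 0 * h (suc n)) + f 0 * ((g ∘ suc) · h) n + ((f ∘ suc) · (g · h)) n
      ≈⟨ +-congʳ (≈-sym (distribˡ _ _ _)) ⟩
    f 0 * (g 0 * h (suc n) + ((g ∘ suc) · h) n) + ((f ∘ suc) · (g · h)) n ∎

  -- The product unfolds along its left factor; this is the mirror recursion along the right factor.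
  -- Commutativity matches one against the other.
  ·-sucʳ : ∀ f g n → (f · g) (suc n) ≈ f (suc n) * g 0 + (f · (g ∘ suc)) n
  ·-sucʳ f g zero    = begin
    f 0 * g 1 + (f 1 * g 0 + 0#)  ≈⟨ +-congˡ (+-identityʳ _) ⟩
    f 0 * g 1 + f 1 * g 0         ≈⟨ +-comm _ _ ⟩
    f 1 * g 0 + f 0 * g 1         ≈⟨ +-congˡ (≈-sym (+-identityʳ _)) ⟩
    f 1 * g 0 + (f 0 * g 1 + 0#)  ∎
  ·-sucʳ f g (suc n) = begin
    a + ((f ∘ suc) · g) (suc n)  ≈⟨ +-congˡ (·-sucʳ (f ∘ suc) g n) ⟩
    a + (b + d)                  ≈⟨ ≈-sym (+-assoc a b d) ⟩
    a + b + d                    ≈⟨ +-congʳ (+-comm a b) ⟩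
    b + a + d                    ≈⟨ +-assoc b a d ⟩
    b + (a + d)                  ∎
    where
    a = f 0 * g (suc (suc n))
    b = f (suc (suc n)) * g 0
    d = ((f ∘ suc) · (g ∘ suc)) n

  ·-comm : ∀ f g → f · g ≋ g · f
  ·-comm f g zero    = +-congʳ (*-comm _ _)
  ·-comm f g (suc n) = ≈-trans (+-cong (*-comm _ _) (·-comm (f ∘ suc) g n)) (≈-sym (·-sucʳ g f n))

  seriesIsCommutativeRing : IsCommutativeRing _≋_ (λ f g n → f n + g n) _·_ (λ f n → - f n) (λ _ → 0#) (constant 1#)
  seriesIsCommutativeRing = record
    { isRing = record
      { +-isAbelianGroup = Pointwise.isAbelianGroup ℕ +-isAbelianGroup
      ; *-cong           = ·-cong
      ; *-assoc          = ·-assoc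
      ; *-identity       = ·-identityˡ , λ f n → ≈-trans (·-comm f (constant 1#) n) (·-identityˡ f n)
      ; distrib          = (λ h f g n → ≈-trans (·-comm h (λ k → f k + g k) n)
                             (≈-trans (·-distribʳ h f g n) (+-cong (·-comm f h n) (·-comm g h n))))
                         , ·-distribʳ
      }
    ; *-comm = ·-comm
    }

  seriesRing : CommutativeRing c ℓ
  seriesRing = record { isCommutativeRing = seriesIsCommutativeRing }

  module Ballot (s : Carrier) where

    -- ballot k is the k-th power of the solution C of C = 1 + s X C²:
    -- multiply that equation by Cᵏ.
    ballot : ℕ → PS
    ballot k       zero    = 1#
    ballot zero    (suc m) = 0#
    ballot (suc k) (suc m) = ballot k (suc m) + s * ballot (suc (suc k)) m

    ballot-zero : ballot 0 ≋ constant 1#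
    ballot-zero zero    = ≈-refl
    ballot-zero (suc m) = ≈-refl

    -- The recursion for powers is linear, so it survives multiplication by `ballot k`. It lowers
    -- the exponent at the same index or raises it at a smaller index, so the induction is on the
    -- index first and then on `j`.
    ballot-· : ∀ j k → ballot j · ballot k ≋ ballot (j ℕ.+ k)
    ballot-· zero    k m       = ≈-trans (·-cong {g = ballot k} ballot-zero (λ _ → ≈-refl) m) (·-identityˡ (ballot k) m)
    ballot-· (suc j) k zero    = ≈-trans (+-identityʳ _) (*-identityˡ 1#)
    ballot-· (suc j) k (suc m) = begin
      1# * ballot k (suc m) + ((λ i → ballot j (suc i) + s * ballot (suc (suc j)) i) · ballot k) m
        ≈⟨ +-congˡ (·-distribʳ (ballot k) (ballot j ∘ suc) (λ i → s * ballot (suc (suc j)) i) m) ⟩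
      1# * ballot k (suc m) + (((ballot j ∘ suc) · ballot k) m + ((λ i → s * ballot (suc (suc j)) i) · ballot k) m)
        ≈⟨ ≈-sym (+-assoc _ _ _) ⟩
      1# * ballot k (suc m) + ((ballot j ∘ suc) · ballot k) m + ((λ i → s * ballot (suc (suc j)) i) · ballot k) m
        -- Every power has constant term 1, so the first two summands are a coefficient of
        -- `ballot j · ballot k`.
        ≡⟨⟩
      (ballot j · ballot k) (suc m) + ((λ i → s * ballot (suc (suc j)) i) · ballot k) m
        ≈⟨ +-cong (ballot-· j k (suc m)) (·-scaleˡ s (ballot (suc (suc j))) (ballot k) m) ⟩
      ballot (j ℕ.+ k) (suc m) + s * (ballot (suc (suc j)) · ballot k) m
        ≈⟨ +-congˡ (*-congˡ (ballot-· (suc (suc j)) k m)) ⟩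
      ballot (suc j ℕ.+ k) (suc m) ∎

    catalan : PS
    catalan = ballot 1

    catalan-suc : ∀ m → catalan (suc m) ≈ s * (catalan · catalan) m
    catalan-suc m = ≈-trans (+-identityˡ _) (*-congˡ (≈-sym (ballot-· 1 1 m)))

-- The functional equations

-- The algebra takes place in any commutative ring that receives ℤ. When ⟦_⟧ is instantiated with
-- `const`, the identities take the form in which the theorem states them.
module _ (R : CommutativeRing 0ℓ 0ℓ)
         (morphism : CommutativeRing.rawRing ℤₚ.+-*-commutativeRing -Raw-AlmostCommutative⟶ fromCommutativeRing R)
         where
  open CommutativeRing R renaming (refl to ≈-refl; sym to ≈-sym; trans to ≈-trans)
  open _-Raw-AlmostCommutative⟶_ morphism using (⟦_⟧)
  open import Relation.Binary.Reasoning.Setoid setoid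

  private
    ⟦⟧-≟ : WeaklyDecidable (Induced-equivalence morphism)
    ⟦⟧-≟ a b with a ℤₚ.≟ b
    ... | yes refl = just ≈-refl
    ... | no  _    = nothing

  open RingSolver _ _ morphism ⟦⟧-≟ using (solve; con; _:=_; _:+_; _:*_; _:-_)

  -- Here `g` stands for y / (1 - y). Replacing one `g` by y (g + 1) turns x g c² into y times
  -- itself plus x y c², which clears the denominator without a division.
  quadratic-equation : ∀ x y g c → g ≈ y * (g + ⟦ 1ℤ ⟧) → c ≈ ⟦ 1ℤ ⟧ + x * (g * (c * c)) →
                       c - ⟦ 1ℤ ⟧ ≈ y * (c - ⟦ 1ℤ ⟧) + x * y * (c * c)
  quadratic-equation x y g c g≈ c≈ = begin
    c - ⟦ 1ℤ ⟧
      ≈⟨ c-1≈ ⟩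
    x * (g * (c * c))
      ≈⟨ *-congˡ (*-congʳ g≈) ⟩
    x * (y * (g + ⟦ 1ℤ ⟧) * (c * c))
      ≈⟨ solve 4 (λ x y g c → x :* (y :* (g :+ con 1ℤ) :* (c :* c))
                           := y :* (x :* (g :* (c :* c))) :+ x :* y :* (c :* c)) ≈-refl x y g c ⟩
    y * (x * (g * (c * c))) + x * y * (c * c)
      ≈⟨ +-congʳ (*-congˡ (≈-sym c-1≈)) ⟩
    y * (c - ⟦ 1ℤ ⟧) + x * y * (c * c) ∎
    where
    c-1≈ : c - ⟦ 1ℤ ⟧ ≈ x * (g * (c * c))
    c-1≈ = ≈-trans (+-congʳ c≈) (solve 1 (λ d → (con 1ℤ :+ d) :- con 1ℤ := d) ≈-refl _)

  module TransferEquations (x y c : Carrier) (c-1≈ : c - ⟦ 1ℤ ⟧ ≈ y * (c - ⟦ 1ℤ ⟧) + x * y * (c * c)) where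

    power : ℕ → Carrier
    power zero    = ⟦ 1ℤ ⟧
    power (suc k) = power k * (⟦ 1ℤ ⟧ + x * c)

    -- At level k + 1 the choices after a column (stop, continue below, continue above) add up to (1
    -- + x) c (1 + x c)^k, and `belowGF` is the telescoping sum of the heads. A column of height one
    -- must be the last, so `headGF 0` is `x` alone.
    headGF belowGF aboveGF : ℕ → Carrier
    headGF zero     = x
    headGF (suc h)  = x * ((⟦ 1ℤ ⟧ + x) * c * power h)
    belowGF zero    = ⟦ 0ℤ ⟧
    belowGF (suc k) = (⟦ 1ℤ ⟧ + x) * power k - ⟦ 1ℤ ⟧
    aboveGF zero    = y * ((⟦ 1ℤ ⟧ + x) * c - ⟦ 1ℤ ⟧)
    aboveGF (suc k) = (⟦ 1ℤ ⟧ + x) * power k * (c - ⟦ 1ℤ ⟧)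

    headGF-suc : ∀ h → headGF (suc h) ≈ x * (⟦ 1ℤ ⟧ + (belowGF (suc h) + aboveGF (suc h)))
    headGF-suc h = solve 3 (λ x c p →
      x :* ((con 1ℤ :+ x) :* c :* p)
      := x :* (con 1ℤ :+ (((con 1ℤ :+ x) :* p :- con 1ℤ) :+ (con 1ℤ :+ x) :* p :* (c :- con 1ℤ))))
      ≈-refl x c (power h)

    belowGF-suc : ∀ k → belowGF (suc k) ≈ belowGF k + headGF k
    belowGF-suc zero    = solve 1 (λ x →
      (con 1ℤ :+ x) :* con 1ℤ :- con 1ℤ := con 0ℤ :+ x) ≈-refl x
    belowGF-suc (suc k) = solve 3 (λ x c p →
      (con 1ℤ :+ x) :* (p :* (con 1ℤ :+ x :* c)) :- con 1ℤ
      := ((con 1ℤ :+ x) :* p :- con 1ℤ) :+ x :* ((con 1ℤ :+ x) :* c :* p)) ≈-refl x c (power k)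

    -- Past level 0 the quadratic equation enters: up to a common factor the claim is c - 1 = y (x c
    -- + (1 + x c)(c - 1)), and the bracket equals c - 1 + x c².
    aboveGF-suc : ∀ k → aboveGF k ≈ y * (headGF k + aboveGF (suc k))
    aboveGF-suc zero    = solve 3 (λ x y c →
      y :* ((con 1ℤ :+ x) :* c :- con 1ℤ)
      := y :* (x :+ (con 1ℤ :+ x) :* con 1ℤ :* (c :- con 1ℤ))) ≈-refl x y c
    aboveGF-suc (suc k) = ≈-trans (*-congˡ c-1≈) (solve 4 (λ x y c p →
      (con 1ℤ :+ x) :* p :* (y :* (c :- con 1ℤ) :+ x :* y :* (c :* c))
      := y :* (x :* ((con 1ℤ :+ x) :* c :* p) :+ (con 1ℤ :+ x) :* (p :* (con 1ℤ :+ x :* c)) :* (c :- con 1ℤ)))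
      ≈-refl x y c (power k))

    -- The quadratic is x y c² - (1 - y) c + (1 - y) = 0, so 2 x y c is 1 - y minus the square root
    -- of the discriminant.
    root : Carrier
    root = ⟦ 1ℤ ⟧ - y - ⟦ + 2 ⟧ * x * y * c

    root-square : root * root ≈ (⟦ + 1 ⟧ - y) * (⟦ + 1 ⟧ - y - ⟦ + 4 ⟧ * x * y)
    root-square = begin
      root * root
        -- The square differs from the discriminant by 4 x y times the defect of the quadratic
        -- equation at `c`.
        ≈⟨ solve 3 (λ x y c →
             (con 1ℤ :- y :- con (+ 2) :* x :* y :* c) :* (con 1ℤ :- y :- con (+ 2) :* x :* y :* c)
             := (con 1ℤ :- y) :* (con 1ℤ :- y :- con (+ 4) :* x :* y)
                :+ con (+ 4) :* x :* y :* ((y :* (c :- con 1ℤ) :+ x :* y :* (c :* c)) :- (c :- con 1ℤ)))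
             ≈-refl x y c ⟩
      D + ⟦ + 4 ⟧ * x * y * ((y * (c - ⟦ 1ℤ ⟧) + x * y * (c * c)) - (c - ⟦ 1ℤ ⟧))
        ≈⟨ +-congˡ (*-congˡ (+-congʳ (≈-sym c-1≈))) ⟩
      D + ⟦ + 4 ⟧ * x * y * ((c - ⟦ 1ℤ ⟧) - (c - ⟦ 1ℤ ⟧))
        ≈⟨ +-congˡ (*-congˡ (-‿inverseʳ _)) ⟩
      D + ⟦ + 4 ⟧ * x * y * 0#
        ≈⟨ ≈-trans (+-congˡ (zeroʳ _)) (+-identityʳ _) ⟩
      D ∎
      where D = (⟦ + 1 ⟧ - y) * (⟦ + 1 ⟧ - y - ⟦ + 4 ⟧ * x * y)

    -- Both sides are linear in `c` and agree as polynomials. The factor 2 x takes the place of the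
    -- denominator of the formula.
    aboveGF-root : ⟦ + 2 ⟧ * x * aboveGF 0 ≈ ⟦ + 1 ⟧ + x - y - ⟦ + 3 ⟧ * x * y - (⟦ + 1 ⟧ + x) * root
    aboveGF-root = solve 3 (λ x y c →
      con (+ 2) :* x :* (y :* ((con 1ℤ :+ x) :* c :- con 1ℤ))
      := con 1ℤ :+ x :- y :- con (+ 3) :* x :* y :- (con 1ℤ :+ x) :* (con 1ℤ :- y :- con (+ 2) :* x :* y :* c))
      ≈-refl x y c

-- Opened only here because _≈_ would clash with the equality of the abstract rings above.
open import Defs
open import Data.List.Membership.DecPropositional _≟ᵉ_ using (_∈?_)
open ≡-Reasoning

-- Bivariate series as power series in x over power series in y

module Y  = PowerSeries ℤₚ.+-*-commutativeRing
module XY = PowerSeries Y.seriesRing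

open import Algebra.Definitions.RawMonoid ℤ.+-0-rawMonoid using () renaming (sum to sumℤ)
open import Algebra.Definitions.RawMonoid (CommutativeRing.+-rawMonoid Y.seriesRing) using () renaming (sum to sumʸ)

sumʸ-coefficient : ∀ {k} (F : Fin k → ℕ → ℤ) n → sumʸ {k} F n ≡ sumℤ (λ i → F i n)
sumʸ-coefficient {zero}  F n = refl
sumʸ-coefficient {suc k} F n = cong (λ a → F zero n ℤ.+ a) (sumʸ-coefficient (F ∘ suc) n)

-- The double sum becomes an iterated Cauchy product once taking a coefficient in y is moved through
-- the outer sum, whose terms are series in y.
⊛-coefficient : ∀ F G → F ⊛ G ≈ F XY.· G
⊛-coefficient F G m n = sym (sumʸ-coefficient {suc m} (λ i → F (toℕ i) Y.· G (m ∸ toℕ i)) n)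

const≈ : ∀ a → const a ≈ XY.constant (Y.constant a)
const≈ a zero    zero    = refl
const≈ a zero    (suc n) = refl
const≈ a (suc m) n       = refl

⊛-rawRing : RawRing 0ℓ 0ℓ
⊛-rawRing = record
  { _≈_ = _≈_ ; _+_ = _⊕_ ; _*_ = _⊛_ ; -_ = λ F m n → ℤ.- F m n ; 0# = λ _ _ → 0ℤ ; 1# = const 1ℤ }

-- Both equalities are the same pointwise equality, so the identity map is a monomorphism into the
-- iterated series ring and the ring laws pull back along it.
⊛-isCommutativeRing : IsCommutativeRing _≈_ _⊕_ _⊛_ (λ F m n → ℤ.- F m n) (λ _ _ → 0ℤ) (const 1ℤ)
⊛-isCommutativeRing = RingMonomorphism.isCommutativeRing isRingMonomorphism XY.seriesIsCommutativeRing
  where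
  open RingMorphisms ⊛-rawRing (CommutativeRing.rawRing XY.seriesRing)
  isRingMonomorphism : IsRingMonomorphism id
  isRingMonomorphism = record
    { isRingHomomorphism = record
      { isSemiringHomomorphism = record
        { isNearSemiringHomomorphism = record
          { +-isMonoidHomomorphism = record
            { isMagmaHomomorphism = record
              { isRelHomomorphism = record { cong = id }
              ; homo = λ _ _ _ _ → refl
              }
            ; ε-homo = λ _ _ → refl
            }
          ; *-homo = ⊛-coefficient
          }
        ; 1#-homo = const≈ 1ℤ
        }
      ; -‿homo = λ _ _ _ → refl
      }
    ; injective = id
    }

seriesRing : CommutativeRing 0ℓ 0ℓ
seriesRing = record { isCommutativeRing = ⊛-isCommutativeRing }

const-⊛ : ∀ a F m n → (const a ⊛ F) m n ≡ a ℤ.* F m n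
const-⊛ a F m n = begin
  (const a ⊛ F) m n                        ≡⟨ ⊛-coefficient (const a) F m n ⟩
  (const a XY.· F) m n                     ≡⟨ XY.·-cong {g = F} (const≈ a) (λ _ _ → refl) m n ⟩
  (XY.constant (Y.constant a) XY.· F) m n  ≡⟨ XY.constant-· (Y.constant a) F m n ⟩
  (Y.constant a Y.· F m) n                 ≡⟨ Y.constant-· a (F m) n ⟩
  a ℤ.* F m n                              ∎

x≈ : x ≈ XY.X
x≈ zero          n       = refl
x≈ (suc zero)    zero    = refl
x≈ (suc zero)    (suc n) = refl
x≈ (suc (suc m)) n       = refl

y≈ : y ≈ XY.constant Y.X
y≈ zero    zero          = refl
y≈ zero    (suc zero)    = refl
y≈ zero    (suc (suc n)) = refl
y≈ (suc m) n             = refl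

-- Multiplying by `x` shifts the first index and multiplying by `y` the second; these rules turn the
-- functional equations into recursions for coefficients.
x⊛-zero : ∀ F n → (x ⊛ F) 0 n ≡ 0ℤ
x⊛-zero F n = trans (⊛-coefficient x F 0 n)
  (trans (XY.·-cong {g = F} x≈ (λ _ _ → refl) 0 n) (XY.X-·-zero F n))

x⊛-suc : ∀ F m n → (x ⊛ F) (suc m) n ≡ F m n
x⊛-suc F m n = trans (⊛-coefficient x F (suc m) n)
  (trans (XY.·-cong {g = F} x≈ (λ _ _ → refl) (suc m) n) (XY.X-·-suc F m n))

y⊛-coefficient : ∀ F m n → (y ⊛ F) m n ≡ (Y.X Y.· F m) n
y⊛-coefficient F m n = trans (⊛-coefficient y F m n)
  (trans (XY.·-cong {g = F} y≈ (λ _ _ → refl) m n) (XY.constant-· Y.X F m n))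

y⊛-zero : ∀ F m → (y ⊛ F) m 0 ≡ 0ℤ
y⊛-zero F m = trans (y⊛-coefficient F m 0) (Y.X-·-zero (F m))

y⊛-suc : ∀ F m n → (y ⊛ F) m (suc n) ≡ F m n
y⊛-suc F m n = trans (y⊛-coefficient F m (suc n)) (Y.X-·-suc (F m) n)

const-morphism : CommutativeRing.rawRing ℤₚ.+-*-commutativeRing -Raw-AlmostCommutative⟶ fromCommutativeRing seriesRing
const-morphism = record
  { ⟦_⟧    = const
  ; +-homo = λ { _ _ zero zero → refl ; _ _ zero (suc _) → refl ; _ _ (suc _) _ → refl }
  ; *-homo = λ a b m n → sym (trans (const-⊛ a (const b) m n) (scale a b m n))
  ; -‿homo = λ { _ zero zero → refl ; _ zero (suc _) → refl ; _ (suc _) _ → refl }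
  ; 0-homo = λ { zero zero → refl ; zero (suc _) → refl ; (suc _) _ → refl }
  ; 1-homo = λ _ _ → refl
  }
  where
  scale : ∀ a b m n → a ℤ.* const b m n ≡ const (a ℤ.* b) m n
  scale a b zero    zero    = refl
  scale a b zero    (suc n) = ℤₚ.*-zeroʳ a
  scale a b (suc m) n       = ℤₚ.*-zeroʳ a

-- The coefficients of y / (1 − y).
geometric : ℕ → ℤ
geometric zero    = 0ℤ
geometric (suc _) = 1ℤ

-- Dividing the quadratic equation by 1 - y gives c = 1 + x (y / (1 - y)) c², the ballot equation
-- with parameter `geometric`.
catalan : Series
catalan = XY.Ballot.catalan geometric

geometricSeries : Series
geometricSeries = XY.constant geometric

geometric-equation : geometricSeries ≈ y ⊛ (geometricSeries ⊕ const 1ℤ)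
geometric-equation m zero = trans (lhs m) (sym (y⊛-zero (geometricSeries ⊕ const 1ℤ) m))
  where
  lhs : ∀ m → geometricSeries m 0 ≡ 0ℤ
  lhs zero    = refl
  lhs (suc m) = refl
geometric-equation m (suc n) = trans (lhs m n) (sym (y⊛-suc (geometricSeries ⊕ const 1ℤ) m n))
  where
  lhs : ∀ m n → geometricSeries m (suc n) ≡ (geometricSeries ⊕ const 1ℤ) m n
  lhs zero    zero    = refl
  lhs zero    (suc n) = refl
  lhs (suc m) n       = refl

catalan-geometric : catalan ≈ const 1ℤ ⊕ x ⊛ (geometricSeries ⊛ (catalan ⊛ catalan))
catalan-geometric zero n = sym (trans (cong (λ a → const 1ℤ 0 n ℤ.+ a) (x⊛-zero (geometricSeries ⊛ (catalan ⊛ catalan)) n))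
  (trans (ℤₚ.+-identityʳ _) (const≈ 1ℤ 0 n)))
catalan-geometric (suc m) n = sym (trans (ℤₚ.+-identityˡ _)
  (trans (x⊛-suc (geometricSeries ⊛ (catalan ⊛ catalan)) m n) (trans (⊛-coefficient geometricSeries (catalan ⊛ catalan) m n)
    (trans (XY.·-cong {f = geometricSeries} (λ _ _ → refl) (⊛-coefficient catalan catalan) m n)
      (trans (XY.constant-· geometric (catalan XY.· catalan) m n)
        (sym (XY.Ballot.catalan-suc geometric m n)))))))

catalan-equation : catalan ⊖ const 1ℤ ≈ y ⊛ (catalan ⊖ const 1ℤ) ⊕ x ⊛ y ⊛ (catalan ⊛ catalan)
catalan-equation = quadratic-equation seriesRing const-morphism x y geometricSeries catalan geometric-equation catalan-geometric

open TransferEquations seriesRing const-morphism x y catalan catalan-equation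

open import Data.Nat.Base using (_+_; _*_)
open import Algebra.Properties.CommutativeSemigroup ℕₚ.+-commutativeSemigroup using (interchange)

-- Enumeration of height sequences

ascent : ℕ → List ℕ → ℕ
ascent k []       = 0
ascent k (h ∷ hs) = (h ∸ k) + ascent (pred h) hs

-- The summand 1 in the equation for H: the sequence stops at this column, so no further columns and
-- no ascent remain.
singleColumn : ℕ → ℕ → ℕ → List (List ℕ)
singleColumn zero    zero    h = [ [ suc h ] ]
singleColumn zero    (suc n) h = []
singleColumn (suc m) n       h = []

-- Sequences of m heights with first height suc h (headed), at most k (below) or more than k
-- (above); n is the ascent from level k, respectively from level h for the tail of a headed one.
headed tails below above : ℕ → ℕ → ℕ → List (List ℕ)
headed zero    n h = []
headed (suc m) n h = singleColumn m n h ++ map (suc h ∷_) (tails m n h)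
tails m n zero    = []
tails m n (suc h) = below m n (suc h) ++ above m n (suc h)
below m n zero    = []
below m n (suc k) = below m n k ++ headed m n k
above m zero    k = []
above m (suc n) k = headed m n k ++ above m n (suc k)

HasHead : ℕ → ℕ → ℕ → List ℕ → Set
HasHead m n h hs = ∃[ ts ] hs ≡ suc h ∷ ts × IsFibonacci hs × length hs ≡ m × ascent h ts ≡ n

HasHead-unique : ∀ {m m′ n n′ h h′ hs} → HasHead m n h hs → HasHead m′ n′ h′ hs → h ≡ h′
HasHead-unique (_ , refl , _) (_ , eq , _) = ℕₚ.suc-injective (∷-injectiveˡ eq)

singleColumn-sound : ∀ m n h {hs} → hs ∈ singleColumn m n h → hs ≡ [ suc h ] × m ≡ 0 × n ≡ 0
singleColumn-sound zero zero h (here refl) = refl , refl , refl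

-- In `above-sound`, `d` counts the levels passed before the head is chosen, so the head rises
-- `suc d` above level `k`. The bound `h ≥ 1` for tails, which start at a positive level only, gives
-- a continued column `suc h` the height at least 2 required of it.
headed-sound : ∀ m n h {hs} → hs ∈ headed m n h → HasHead m n h hs
tails-sound  : ∀ m n h {hs} → hs ∈ tails m n h → h ≥ 1 × IsFibonacci hs × length hs ≡ m × ascent h hs ≡ n
below-sound  : ∀ m n k {hs} → hs ∈ below m n k → ∃[ h ] h < k × HasHead m n h hs
above-sound  : ∀ m n k {hs} → hs ∈ above m n k → ∃[ d ] ∃[ n′ ] suc (d + n′) ≡ n × HasHead m n′ (d + k) hs

headed-sound (suc m) n h hs∈ with ∈-++⁻ (singleColumn m n h) hs∈
... | inj₁ p with refl , refl , refl ← singleColumn-sound m n h p =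
  [] , refl , last (s≤s z≤n) , refl , refl
... | inj₂ p with ts , ts∈ , refl ← ∈-map⁻ (suc h ∷_) p
  with h≥1 , fib , len , asc ← tails-sound m n h ts∈ =
  ts , refl , s≤s h≥1 ∷ fib , cong suc len , asc

tails-sound m n (suc h) hs∈ with ∈-++⁻ (below m n (suc h)) hs∈
... | inj₁ p with h′ , h′<k , ts , refl , fib , len , asc ← below-sound m n (suc h) p =
  s≤s z≤n , fib , len , trans (cong (_+ ascent h′ ts) (ℕₚ.m≤n⇒m∸n≡0 h′<k)) asc
... | inj₂ p with d , n′ , refl , ts , refl , fib , len , refl ← above-sound m n (suc h) p =
  s≤s z≤n , fib , len , cong (_+ n′) (ℕₚ.m+n∸n≡m (suc d) (suc h))

below-sound m n (suc k) hs∈ with ∈-++⁻ (below m n k) hs∈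
... | inj₁ p with h , h<k , r ← below-sound m n k p = h , ℕₚ.m<n⇒m<1+n h<k , r
... | inj₂ p = k , ℕₚ.≤-refl , headed-sound m n k p

above-sound m (suc n) k {hs} hs∈ with ∈-++⁻ (headed m n k) hs∈
... | inj₁ p = 0 , n , refl , headed-sound m n k p
... | inj₂ p with d , n′ , eq , r ← above-sound m n (suc k) p =
  suc d , n′ , cong suc eq , subst (λ h → HasHead m n′ h hs) (ℕₚ.+-suc d k) r

below-⊇ : ∀ m n {h k hs} → h < k → hs ∈ headed m n h → hs ∈ below m n k
below-⊇ m n {h} {suc k} (s≤s h≤k) hs∈ with ℕₚ.m≤n⇒m<n∨m≡n h≤k
... | inj₁ h<k  = ∈-++⁺ˡ (below-⊇ m n h<k hs∈)
... | inj₂ refl = ∈-++⁺ʳ (below m n k) hs∈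

-- Each level passed costs one unit of ascent and choosing the head costs one more. The climb moves
-- units from `d` to `k`, keeping the sum `d + k`.
above-⊇ : ∀ m n d k {hs} → hs ∈ headed m n (d + k) → hs ∈ above m (suc (d + n)) k
above-⊇ m n zero    k hs∈ = ∈-++⁺ˡ hs∈
above-⊇ m n (suc d) k {hs} hs∈ = ∈-++⁺ʳ (headed m (suc (d + n)) k)
  (above-⊇ m n d (suc k) (subst (λ h → hs ∈ headed m n h) (sym (ℕₚ.+-suc d k)) hs∈))

headed-complete : ∀ h ts → IsFibonacci (suc h ∷ ts) → (suc h ∷ ts) ∈ headed (suc (length ts)) (ascent h ts) h
complete : ∀ k hs → IsFibonacci hs → hs ∈ below (length hs) (ascent k hs) k ++ above (length hs) (ascent k hs) k

headed-complete h       [] (last _)            = here refl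
headed-complete zero    ts (s≤s () ∷ fib)
headed-complete (suc h) ts (_ ∷ fib) = ∈-++⁺ʳ (singleColumn (length ts) _ (suc h))
  (∈-map⁺ (suc (suc h) ∷_) (complete (suc h) ts fib))

complete k (suc h ∷ ts) fib with h ℕₚ.<? k
... | yes h<k = ∈-++⁺ˡ (below-⊇ m _ h<k (subst (λ a → (suc h ∷ ts) ∈ headed m a h) asc (headed-complete h ts fib)))
  where
  m = suc (length ts)
  asc : ascent h ts ≡ (suc h ∸ k) + ascent h ts
  asc = sym (cong (_+ ascent h ts) (ℕₚ.m≤n⇒m∸n≡0 h<k))
-- The rise from level `k` is `suc (h ∸ k)`, so the head is chosen after passing `h ∸ k` levels.
... | no  h≮k = ∈-++⁺ʳ (below _ (ascent k (suc h ∷ ts)) k)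
  (subst (λ a → (suc h ∷ ts) ∈ above m (a + ascent h ts) k) (sym (ℕₚ.+-∸-assoc 1 k≤h))
    (above-⊇ m (ascent h ts) (h ∸ k) k
      (subst (λ h′ → (suc h ∷ ts) ∈ headed m (ascent h ts) h′) (sym (ℕₚ.m∸n+n≡m k≤h)) (headed-complete h ts fib))))
  where
  m   = suc (length ts)
  k≤h = ℕₚ.≮⇒≥ h≮k
complete k (zero ∷ []) (last ())
complete k (zero ∷ ts) (() ∷ fib)

-- Concatenated lists are told apart by the first height, and a single column is told apart from a
-- longer sequence by its empty tail. Without repetitions, list positions correspond to sequences
-- one to one.
headed-unique : ∀ m n h → Unique (headed m n h)
tails-unique  : ∀ m n h → Unique (tails m n h)
below-unique  : ∀ m n k → Unique (below m n k)
above-unique  : ∀ m n k → Unique (above m n k)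

singleColumn-unique : ∀ m n h → Unique (singleColumn m n h)
singleColumn-unique zero    zero    h = [] ∷ []
singleColumn-unique zero    (suc n) h = []
singleColumn-unique (suc m) n       h = []

headed-unique zero    n h = []
headed-unique (suc m) n h = Unique.++⁺ (singleColumn-unique m n h)
  (Unique.map⁺ ∷-injectiveʳ (tails-unique m n h)) disjoint
  where
  disjoint : Disjoint (singleColumn m n h) (map (suc h ∷_) (tails m n h))
  disjoint (p , q) with refl , _ ← singleColumn-sound m n h p
    with ts , ts∈ , refl ← ∈-map⁻ (suc h ∷_) q
    -- The tail would be empty, and the empty sequence is not Fibonacci.
    with _ , () , _ ← tails-sound m n h ts∈

tails-unique m n zero    = []
tails-unique m n (suc h) = Unique.++⁺ (below-unique m n (suc h)) (above-unique m n (suc h)) disjoint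
  where
  disjoint : Disjoint (below m n (suc h)) (above m n (suc h))
  disjoint (p , q) with h′ , h′<k , r ← below-sound m n (suc h) p
    with d , _ , _ , r′ ← above-sound m n (suc h) q
    with refl ← HasHead-unique r r′ = ℕₚ.m+n≮n d (suc h) h′<k

below-unique m n zero    = []
below-unique m n (suc k) = Unique.++⁺ (below-unique m n k) (headed-unique m n k) disjoint
  where
  disjoint : Disjoint (below m n k) (headed m n k)
  disjoint (p , q) with h , h<k , r ← below-sound m n k p
    with refl ← HasHead-unique r (headed-sound m n k q) = ℕₚ.n≮n h h<k

above-unique m zero    k = []
above-unique m (suc n) k = Unique.++⁺ (headed-unique m n k) (above-unique m n (suc k)) disjoint
  where
  disjoint : Disjoint (headed m n k) (above m n (suc k))
  disjoint (p , q) with d , _ , _ , r ← above-sound m n (suc k) q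
    with eq ← HasHead-unique (headed-sound m n k p) r = ℕₚ.m+n≮n d k (ℕₚ.≤-reflexive (sym (trans eq (ℕₚ.+-suc d k))))

-- List lengths as coefficients

private
  +length-++ : ∀ {A : Set} (xs ys : List A) {a b} → + length xs ≡ a → + length ys ≡ b → + length (xs ++ ys) ≡ a ℤ.+ b
  +length-++ xs ys p q = trans (cong +_ (length-++ xs)) (cong₂ ℤ._+_ p q)

singleColumn-count : ∀ m n h → + length (singleColumn m n h) ≡ const 1ℤ m n
singleColumn-count zero    zero    h = refl
singleColumn-count zero    (suc n) h = refl
singleColumn-count (suc m) n       h = refl

-- The lists are built by the recursion that the functional equations impose on coefficients, so
-- lengths and coefficients agree by induction along that recursion. At `n = 0` the factor `y`
-- matches the empty `above`.
headed-count : ∀ m n h → + length (headed m n h) ≡ headGF h m n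
below-count  : ∀ m n k → + length (below m n k) ≡ belowGF k m n
above-count  : ∀ m n k → + length (above m n k) ≡ aboveGF k m n

headed-count zero    n zero    = refl
headed-count zero    n (suc h) = sym (x⊛-zero ((const 1ℤ ⊕ x) ⊛ catalan ⊛ power h) n)
headed-count (suc m) n zero    = trans (+length-++ (singleColumn m n 0) [] (singleColumn-count m n 0) refl)
  (trans (ℤₚ.+-identityʳ _) (x-suc m n))
  where
  x-suc : ∀ m n → const 1ℤ m n ≡ x (suc m) n
  x-suc zero    zero    = refl
  x-suc zero    (suc n) = refl
  x-suc (suc m) n       = refl
headed-count (suc m) n (suc h) = begin
  + length (headed (suc m) n (suc h))
    ≡⟨ +length-++ (singleColumn m n (suc h)) _ (singleColumn-count m n (suc h))
         (trans (cong +_ (length-map (suc (suc h) ∷_) (tails m n (suc h))))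
           (+length-++ (below m n (suc h)) _ (below-count m n (suc h)) (above-count m n (suc h)))) ⟩
  (const 1ℤ ⊕ (belowGF (suc h) ⊕ aboveGF (suc h))) m n
    ≡⟨ x⊛-suc (const 1ℤ ⊕ (belowGF (suc h) ⊕ aboveGF (suc h))) m n ⟨
  (x ⊛ (const 1ℤ ⊕ (belowGF (suc h) ⊕ aboveGF (suc h)))) (suc m) n
    ≡⟨ headGF-suc h (suc m) n ⟨
  headGF (suc h) (suc m) n ∎

below-count m n zero    = sym (const0 m n)
  where
  const0 : ∀ m n → const 0ℤ m n ≡ 0ℤ
  const0 zero    zero    = refl
  const0 zero    (suc n) = refl
  const0 (suc m) n       = refl
below-count m n (suc k) = trans
  (+length-++ (below m n k) (headed m n k) (below-count m n k) (headed-count m n k)) (sym (belowGF-suc k m n))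

above-count m zero    k = sym (trans (aboveGF-suc k m 0) (y⊛-zero (headGF k ⊕ aboveGF (suc k)) m))
above-count m (suc n) k = trans
  (+length-++ (headed m n k) (above m n (suc k)) (headed-count m n k) (above-count m n (suc k)))
  (sym (trans (aboveGF-suc k m (suc n)) (y⊛-suc (headGF k ⊕ aboveGF (suc k)) m n)))

-- Boundary lengths

χ : Bool → ℕ
χ b = if b then 1 else 0

isOne : ℕ → ℕ
isOne n = χ (n ≡ᵇ 1)

tally : (ℕ → ℕ) → ℕ → ℕ
tally f zero    = 0
tally f (suc n) = f 0 + tally (f ∘ suc) n

tally-cong : ∀ {f g} n → (∀ k → k < n → f k ≡ g k) → tally f n ≡ tally g n
tally-cong zero    f≗g = refl
tally-cong (suc n) f≗g = cong₂ _+_ (f≗g 0 (s≤s z≤n)) (tally-cong n (λ k k<n → f≗g (suc k) (s≤s k<n)))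

tally-+ : ∀ f g n → tally (λ k → f k + g k) n ≡ tally f n + tally g n
tally-+ f g zero    = refl
tally-+ f g (suc n) = trans (cong (_+_ _) (tally-+ (f ∘ suc) (g ∘ suc) n)) (interchange (f 0) (g 0) _ _)

tally-zero : ∀ n → tally (λ _ → 0) n ≡ 0
tally-zero zero    = refl
tally-zero (suc n) = tally-zero n

tally-one : ∀ n → tally (λ _ → 1) n ≡ n
tally-one zero    = refl
tally-one (suc n) = cong suc (tally-one n)

tally-≡ᵇ : ∀ k n → tally (λ j → χ (j ≡ᵇ k)) n ≡ χ (k <ᵇ n)
tally-≡ᵇ k       zero    = refl
tally-≡ᵇ zero    (suc n) = cong suc (tally-zero n)
tally-≡ᵇ (suc k) (suc n) = tally-≡ᵇ k n

tally-≮ᵇ : ∀ p n → tally (λ k → χ (not (k <ᵇ p))) n ≡ n ∸ p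
tally-≮ᵇ zero    n       = tally-one n
tally-≮ᵇ (suc p) zero    = refl
tally-≮ᵇ (suc p) (suc n) = tally-≮ᵇ p n

χ-< : ∀ {k n} → k < n → χ (k <ᵇ n) ≡ 1
χ-< {zero}  (s≤s _)   = refl
χ-< {suc k} (s≤s k<n) = χ-< k<n

-- An edge of one cell stays on the boundary exactly when the neighbouring cell, whose presence is
-- `b`, is absent.
isOne-+χ : ∀ b → isOne (χ b + 1) ≡ χ (not b)
isOne-+χ true  = refl
isOne-+χ false = refl

module _ {A : Set} {P : Pred A 0ℓ} (P? : Decidable P) where

  length-filter-++ : ∀ xs ys → length (filter P? (xs ++ ys)) ≡ length (filter P? xs) + length (filter P? ys)
  length-filter-++ xs ys = trans (cong length (filter-++ P? xs ys)) (length-++ (filter P? xs))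

  length-filter-∷ : ∀ x xs → length (filter P? (x ∷ xs)) ≡ χ (does (P? x)) + length (filter P? xs)
  length-filter-∷ x xs with does (P? x)
  ... | true  = refl
  ... | false = refl

  length-filter-applyUpTo : ∀ f n → length (filter P? (applyUpTo f n)) ≡ tally (λ k → χ (does (P? (f k)))) n
  length-filter-applyUpTo f zero    = refl
  length-filter-applyUpTo f (suc n) =
    trans (length-filter-∷ (f 0) _) (cong (_+_ _) (length-filter-applyUpTo (f ∘ suc) n))

incidence-++ : ∀ edges as bs e → incidence edges (as ++ bs) e ≡ incidence edges as e + incidence edges bs e
incidence-++ edges as bs e = length-filter-++ (λ c → e ∈? edges c) as bs

incidence-column : ∀ edges i h e →
  incidence edges (column i h) e ≡ tally (λ k → χ (does (e ∈? edges (i , i + k)))) h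
incidence-column edges i h e = trans
  (cong (λ cs → incidence edges cs e) (map-upTo (λ k → i , i + k) h))
  (length-filter-applyUpTo (λ c → e ∈? edges c) (λ k → i , i + k) h)

incidence-column-none : ∀ edges i h e → (∀ k → ¬ e ∈ edges (i , i + k)) → incidence edges (column i h) e ≡ 0
incidence-column-none edges i h e e∉ = trans (incidence-column edges i h e)
  (trans (tally-cong h (λ k _ → cong χ (dec-false (e ∈? edges (i , i + k)) (e∉ k)))) (tally-zero h))

incidence-column-one : ∀ edges i h e k → (∀ j → e ∈ edges (i , i + j) ⇔ j ≡ k) →
  incidence edges (column i h) e ≡ χ (k <ᵇ h)
incidence-column-one edges i h e k e∈ = trans (incidence-column edges i h e)
  (trans (tally-cong h (λ j _ → cong χ (does-⇔ (e∈ j) (e ∈? edges (i , i + j)) (j ℕₚ.≟ k)))) (tally-≡ᵇ k h))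

-- No edge starts to the left of its cell, so columns from `i` on cannot reach an edge with smaller
-- abscissa.
incidence-columnsFrom : ∀ edges → (∀ {c r c′ r′} → (c , r) ∈ edges (c′ , r′) → c′ ≤ c) →
  ∀ i hs {c r} → c < i → incidence edges (columnsFrom i hs) (c , r) ≡ 0
incidence-columnsFrom edges edges≥ i []       c<i = refl
incidence-columnsFrom edges edges≥ i (h ∷ hs) {c} {r} c<i = begin
  incidence edges (column i h ++ columnsFrom (suc i) hs) (c , r)
    ≡⟨ incidence-++ edges (column i h) _ _ ⟩
  incidence edges (column i h) (c , r) + incidence edges (columnsFrom (suc i) hs) (c , r)
    ≡⟨ cong₂ _+_ (incidence-column-none edges i h _ (λ _ e∈ → ℕₚ.<⇒≱ c<i (edges≥ e∈)))
                 (incidence-columnsFrom edges edges≥ (suc i) hs (ℕₚ.m<n⇒m<1+n c<i)) ⟩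
  0 ∎

-- In the inductions on columns below, the weight of an edge is its incidence g with the columns
-- already passed plus its incidence with the remaining ones.
ones : (Edge → ℕ) → List Edge → ℕ
ones f es = length (filter (λ e → f e ℕₚ.≟ 1) es)

ones-∷ : ∀ f e es → ones f (e ∷ es) ≡ isOne (f e) + ones f es
ones-∷ f = length-filter-∷ (λ e → f e ℕₚ.≟ 1)

ones-cong : ∀ {f g} → (∀ e → f e ≡ g e) → ∀ es → ones f es ≡ ones g es
ones-cong         f≗g []       = refl
ones-cong {f} {g} f≗g (e ∷ es) = begin
  ones f (e ∷ es)            ≡⟨ ones-∷ f e es ⟩
  isOne (f e) + ones f es    ≡⟨ cong₂ _+_ (cong isOne (f≗g e)) (ones-cong f≗g es) ⟩
  isOne (g e) + ones g es    ≡⟨ ones-∷ g e es ⟨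
  ones g (e ∷ es)            ∎

module _ (edges : Cell → List Edge) (a b : ℕ → ℕ → Edge)
         (edges≡ : ∀ i k → edges (i , i + k) ≡ a i k ∷ b i k ∷ []) where

  -- The row function `φ` is general because the induction on `h` shifts it.
  ones-applyUpTo : ∀ f i (φ : ℕ → ℕ) h → ones f (concatMap edges (applyUpTo (λ k → i , i + φ k) h))
    ≡ tally (λ k → isOne (f (a i (φ k))) + isOne (f (b i (φ k)))) h
  ones-applyUpTo f i φ zero    = refl
  ones-applyUpTo f i φ (suc h) rewrite edges≡ i (φ 0) = begin
    ones f (a i (φ 0) ∷ b i (φ 0) ∷ rest)
      ≡⟨ ones-∷ f (a i (φ 0)) (b i (φ 0) ∷ rest) ⟩
    isOne (f (a i (φ 0))) + ones f (b i (φ 0) ∷ rest)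
      ≡⟨ cong (_+_ (isOne (f (a i (φ 0))))) (ones-∷ f (b i (φ 0)) rest) ⟩
    isOne (f (a i (φ 0))) + (isOne (f (b i (φ 0))) + ones f rest)
      ≡⟨ ℕₚ.+-assoc (isOne (f (a i (φ 0)))) _ _ ⟨
    isOne (f (a i (φ 0))) + isOne (f (b i (φ 0))) + ones f rest
      ≡⟨ cong (_+_ _) (ones-applyUpTo f i (φ ∘ suc) h) ⟩
    _ ∎
    where rest = concatMap edges (applyUpTo (λ k → i , i + φ (suc k)) h)

  -- Once the edges of the first column are tallied, its incidence is absorbed into `g`; the rest
  -- then has the original shape and an induction on columns can proceed.
  ones-columnsFrom : ∀ (g : Edge → ℕ) i h hs →
    ones (λ e → g e + incidence edges (columnsFrom i (h ∷ hs)) e) (concatMap edges (columnsFrom i (h ∷ hs)))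
    ≡ tally (λ k → isOne (g (a i k) + (incidence edges (column i h) (a i k) + incidence edges (columnsFrom (suc i) hs) (a i k)))) h
      + tally (λ k → isOne (g (b i k) + (incidence edges (column i h) (b i k) + incidence edges (columnsFrom (suc i) hs) (b i k)))) h
      + ones (λ e → (g e + incidence edges (column i h) e) + incidence edges (columnsFrom (suc i) hs) e)
             (concatMap edges (columnsFrom (suc i) hs))
  ones-columnsFrom g i h hs = begin
    ones (λ e → g e + incidence edges (columnsFrom i (h ∷ hs)) e) (concatMap edges (col ++ cols))
      ≡⟨ ones-cong (λ e → cong (_+_ (g e)) (incidence-++ edges col cols e)) (concatMap edges (col ++ cols)) ⟩
    ones f (concatMap edges (col ++ cols))
      ≡⟨ cong (ones f) (concatMap-++ edges col cols) ⟩
    ones f (concatMap edges col ++ concatMap edges cols)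
      ≡⟨ length-filter-++ (λ e → f e ℕₚ.≟ 1) (concatMap edges col) _ ⟩
    ones f (concatMap edges col) + ones f (concatMap edges cols)
      ≡⟨ cong₂ _+_ column-part (ones-cong (λ e → sym (ℕₚ.+-assoc (g e) _ _)) (concatMap edges cols)) ⟩
    _ ∎
    where
    col  = column i h
    cols = columnsFrom (suc i) hs
    f : Edge → ℕ
    f e = g e + (incidence edges col e + incidence edges cols e)
    column-part : ones f (concatMap edges col) ≡ tally (λ k → isOne (f (a i k))) h + tally (λ k → isOne (f (b i k))) h
    column-part = trans (cong (λ cs → ones f (concatMap edges cs)) (map-upTo (λ k → i , i + k) h))
      (trans (ones-applyUpTo f i id h) (tally-+ (λ k → isOne (f (a i k))) (λ k → isOne (f (b i k))) h))

-- Vertical boundary edges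

verticalEdges-≥ : ∀ {c r c′ r′} → (c , r) ∈ verticalEdges (c′ , r′) → c′ ≤ c
verticalEdges-≥ (here refl)         = ℕₚ.≤-refl
verticalEdges-≥ (there (here refl)) = ℕₚ.n≤1+n _

verticalEdges-≤ : ∀ {c r c′ r′} → (c , r) ∈ verticalEdges (c′ , r′) → c ≤ suc c′
verticalEdges-≤ (here refl)         = ℕₚ.n≤1+n _
verticalEdges-≤ (there (here refl)) = ℕₚ.≤-refl

verticalEdges-row : ∀ {c r c′ r′} → (c , r) ∈ verticalEdges (c′ , r′) → r ≡ r′
verticalEdges-row (here refl)         = refl
verticalEdges-row (there (here refl)) = refl

left-incidence : ∀ i h k → incidence verticalEdges (column i h) (i , i + k) ≡ χ (k <ᵇ h)
left-incidence i h k = incidence-column-one verticalEdges i h (i , i + k) k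
  (λ j → mk⇔ (λ e∈ → sym (ℕₚ.+-cancelˡ-≡ i _ _ (verticalEdges-row e∈))) (λ { refl → here refl }))

right-incidence : ∀ i h k → incidence verticalEdges (column i h) (suc i , i + k) ≡ χ (k <ᵇ h)
right-incidence i h k = incidence-column-one verticalEdges i h (suc i , i + k) k
  (λ j → mk⇔ (λ e∈ → sym (ℕₚ.+-cancelˡ-≡ i _ _ (verticalEdges-row e∈))) (λ { refl → there (here refl) }))

-- Counts the right edges of a column left uncovered by the next one: always the lowest, because the
-- next column starts one row higher, and those above the top of the next column.
gap : ℕ → List ℕ → ℕ
gap h []       = h
gap h (h′ ∷ _) = suc (pred h ∸ h′)

-- `p` is how far the preceding column reaches above the bottom of the current one; it hides the
-- left edges in those rows.
verticalLength : ℕ → List ℕ → ℕ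
verticalLength p []       = 0
verticalLength p (h ∷ hs) = (h ∸ p) + gap h hs + verticalLength (pred h) hs

verticalLength-gap : ∀ i h hs → h ≥ 1 →
  tally (λ k → isOne (1 + incidence verticalEdges (columnsFrom (suc i) hs) (suc i , i + k))) h ≡ gap h hs
verticalLength-gap i h       []        h≥1 = tally-one h
verticalLength-gap i (suc h) (h′ ∷ hs) h≥1 = cong₂ _+_ (cong (λ n → isOne (1 + n)) bottom)
  (trans (tally-cong h (λ k _ → trans (cong (λ n → isOne (1 + n)) (higher k))
    (trans (cong isOne (ℕₚ.+-comm 1 (χ (k <ᵇ h′)))) (isOne-+χ (k <ᵇ h′))))) (tally-≮ᵇ h′ h))
  where
  next : ∀ r → incidence verticalEdges (columnsFrom (suc i) (h′ ∷ hs)) (suc i , r)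
             ≡ incidence verticalEdges (column (suc i) h′) (suc i , r)
  next r = trans (incidence-++ verticalEdges (column (suc i) h′) _ _)
    (trans (cong (_+_ _) (incidence-columnsFrom verticalEdges verticalEdges-≥ (suc (suc i)) hs ℕₚ.≤-refl)) (ℕₚ.+-identityʳ _))
  bottom : incidence verticalEdges (columnsFrom (suc i) (h′ ∷ hs)) (suc i , i + 0) ≡ 0
  bottom = trans (next (i + 0)) (incidence-column-none verticalEdges (suc i) h′ _
    (λ k e∈ → ℕₚ.m≢1+m+n i (trans (sym (ℕₚ.+-identityʳ i)) (verticalEdges-row e∈))))
  higher : ∀ k → incidence verticalEdges (columnsFrom (suc i) (h′ ∷ hs)) (suc i , i + suc k) ≡ χ (k <ᵇ h′)
  higher k = trans (next (i + suc k))
    (trans (cong (λ r → incidence verticalEdges (column (suc i) h′) (suc i , r)) (ℕₚ.+-suc i k)) (left-incidence (suc i) h′ k))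

-- Invariant: at abscissa `i`, among the rows from `i` up, the passed columns occupy exactly the
-- first `p`, and they have no edge further right. A column of height `h` restores this at `suc i`
-- with `pred h`, because the base row also moves up by one.
vertical-ones : ∀ (g : Edge → ℕ) i p hs → (∀ k → g (i , i + k) ≡ χ (k <ᵇ p)) → (∀ c r → i < c → g (c , r) ≡ 0) → All (_≥ 1) hs →
  ones (λ e → g e + incidence verticalEdges (columnsFrom i hs) e) (concatMap verticalEdges (columnsFrom i hs))
  ≡ verticalLength p hs
vertical-ones g i p []       gᵢ g₀ []          = refl
vertical-ones g i p (h ∷ hs) gᵢ g₀ (h≥1 ∷ hs≥1) = trans
  (ones-columnsFrom verticalEdges (λ i k → i , i + k) (λ i k → suc i , i + k) (λ _ _ → refl) g i h hs)
  (cong₂ _+_ (cong₂ _+_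
    (trans (tally-cong h (λ k k<h → trans (cong isOne (left k k<h)) (isOne-+χ (k <ᵇ p)))) (tally-≮ᵇ p h))
    (trans (tally-cong h (λ k k<h → cong isOne (right k k<h))) (verticalLength-gap i h hs h≥1)))
    (vertical-ones _ (suc i) (pred h) hs gᵢ′ g₀′ hs≥1))
  where
  left : ∀ k → k < h → g (i , i + k) + (incidence verticalEdges (column i h) (i , i + k)
    + incidence verticalEdges (columnsFrom (suc i) hs) (i , i + k)) ≡ χ (k <ᵇ p) + 1
  left k k<h = cong₂ _+_ (gᵢ k) (cong₂ _+_ (trans (left-incidence i h k) (χ-< k<h))
    (incidence-columnsFrom verticalEdges verticalEdges-≥ (suc i) hs ℕₚ.≤-refl))
  right : ∀ k → k < h → g (suc i , i + k) + (incidence verticalEdges (column i h) (suc i , i + k)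
    + incidence verticalEdges (columnsFrom (suc i) hs) (suc i , i + k))
    ≡ 1 + incidence verticalEdges (columnsFrom (suc i) hs) (suc i , i + k)
  right k k<h = cong₂ _+_ (g₀ (suc i) (i + k) ℕₚ.≤-refl)
    (cong (_+ incidence verticalEdges (columnsFrom (suc i) hs) (suc i , i + k)) (trans (right-incidence i h k) (χ-< k<h)))
  χ-pred : ∀ h → h ≥ 1 → ∀ k → χ (suc k <ᵇ h) ≡ χ (k <ᵇ pred h)
  χ-pred (suc h) _ k = refl
  gᵢ′ : ∀ k → g (suc i , suc i + k) + incidence verticalEdges (column i h) (suc i , suc i + k) ≡ χ (k <ᵇ pred h)
  gᵢ′ k = cong₂ _+_ (g₀ (suc i) (suc i + k) ℕₚ.≤-refl)
    (trans (cong (λ r → incidence verticalEdges (column i h) (suc i , r)) (sym (ℕₚ.+-suc i k)))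
      (trans (right-incidence i h (suc k)) (χ-pred h h≥1 k)))
  g₀′ : ∀ c r → suc i < c → g (c , r) + incidence verticalEdges (column i h) (c , r) ≡ 0
  g₀′ c r i<c = cong₂ _+_ (g₀ c r (ℕₚ.<-trans (ℕₚ.n<1+n i) i<c))
    (incidence-column-none verticalEdges i h (c , r) (λ k e∈ → ℕₚ.<⇒≱ i<c (verticalEdges-≤ e∈)))

-- Both sides are the maximum of `m` and `n`.
m∸n+n≡n∸m+m : ∀ m n → (m ∸ n) + n ≡ (n ∸ m) + m
m∸n+n≡n∸m+m zero    zero    = refl
m∸n+n≡n∸m+m zero    (suc n) = sym (ℕₚ.+-identityʳ (suc n))
m∸n+n≡n∸m+m (suc m) zero    = ℕₚ.+-identityʳ (suc m)
m∸n+n≡n∸m+m (suc m) (suc n) = trans (ℕₚ.+-suc (m ∸ n) n)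
  (trans (cong suc (m∸n+n≡n∸m+m m n)) (sym (ℕₚ.+-suc (n ∸ m) m)))

-- The descent p ∸ h into the first column, counted by the gap of the column before it, is
-- added so that rises and falls balance.
verticalLength-ascent : ∀ p h hs → All (_≥ 1) (h ∷ hs) →
  verticalLength p (h ∷ hs) + (p ∸ h) ≡ 2 * ascent p (h ∷ hs) + p
verticalLength-ascent p h [] _ = begin
  (h ∸ p) + h + 0 + (p ∸ h)      ≡⟨ rearrange (h ∸ p) h (p ∸ h) ⟩
  (h ∸ p) + ((p ∸ h) + h)        ≡⟨ cong (_+_ (h ∸ p)) (m∸n+n≡n∸m+m p h) ⟩
  (h ∸ p) + ((h ∸ p) + p)        ≡⟨ rearrange′ (h ∸ p) p ⟩
  2 * ((h ∸ p) + 0) + p          ∎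
  where
  rearrange : ∀ a b c → a + b + 0 + c ≡ a + (c + b)
  rearrange = solve-∀
  rearrange′ : ∀ a b → a + (a + b) ≡ 2 * (a + 0) + b
  rearrange′ = solve-∀
verticalLength-ascent p (suc h) (h′ ∷ hs) (_ ∷ hs≥1) = begin
  (suc h ∸ p) + suc (h ∸ h′) + v + (p ∸ suc h)
    ≡⟨ rearrange (suc h ∸ p) (h ∸ h′) v (p ∸ suc h) ⟩
  (suc h ∸ p) + suc (p ∸ suc h) + (v + (h ∸ h′))
    ≡⟨ cong (_+_ ((suc h ∸ p) + suc (p ∸ suc h))) (verticalLength-ascent h h′ hs hs≥1) ⟩
  (suc h ∸ p) + suc (p ∸ suc h) + (2 * s + h)
    ≡⟨ rearrange′ (suc h ∸ p) (p ∸ suc h) s h ⟩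
  (suc h ∸ p) + ((p ∸ suc h) + suc h) + 2 * s
    ≡⟨ cong (λ n → (suc h ∸ p) + n + 2 * s) (m∸n+n≡n∸m+m p (suc h)) ⟩
  (suc h ∸ p) + ((suc h ∸ p) + p) + 2 * s
    ≡⟨ rearrange″ (suc h ∸ p) p s ⟩
  2 * ((suc h ∸ p) + s) + p ∎
  where
  v = verticalLength h (h′ ∷ hs)
  s = ascent h (h′ ∷ hs)
  rearrange : ∀ a b c d → a + suc b + c + d ≡ a + suc d + (c + b)
  rearrange = solve-∀
  rearrange′ : ∀ a b c d → a + suc b + (2 * c + d) ≡ a + (b + suc d) + 2 * c
  rearrange′ = solve-∀
  rearrange″ : ∀ a b c → a + (a + b) + 2 * c ≡ 2 * (a + c) + b
  rearrange″ = solve-∀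

positive : ∀ {hs} → IsFibonacci hs → All (_≥ 1) hs
positive (last h≥1)  = h≥1 ∷ []
positive (h≥2 ∷ fib) = ℕₚ.<⇒≤ h≥2 ∷ positive fib

vertical-length : ∀ {hs} → IsFibonacci hs → length (boundary verticalEdges (cells hs)) ≡ 2 * ascent 0 hs
vertical-length {h ∷ hs} fib = begin
  length (boundary verticalEdges (cells (h ∷ hs)))
    -- Columns are numbered from 1, and nothing precedes the first: weight 0 and level 0.
    ≡⟨ vertical-ones (λ _ → 0) 1 0 (h ∷ hs) (λ _ → refl) (λ _ _ _ → refl) (positive fib) ⟩
  verticalLength 0 (h ∷ hs)                ≡⟨ ℕₚ.+-identityʳ _ ⟨
  verticalLength 0 (h ∷ hs) + 0            ≡⟨ cong (_+_ (verticalLength 0 (h ∷ hs))) (ℕₚ.0∸n≡0 h) ⟨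
  verticalLength 0 (h ∷ hs) + (0 ∸ h)      ≡⟨ verticalLength-ascent 0 h hs (positive fib) ⟩
  2 * ascent 0 (h ∷ hs) + 0                ≡⟨ ℕₚ.+-identityʳ _ ⟩
  2 * ascent 0 (h ∷ hs)                    ∎

-- Horizontal boundary edges

horizontalEdges-column : ∀ {c r c′ r′} → (c , r) ∈ horizontalEdges (c′ , r′) → c ≡ c′
horizontalEdges-column (here refl)         = refl
horizontalEdges-column (there (here refl)) = refl

-- The edge at height `suc k` in a column is the bottom of cell `suc k` and the top of cell `k`; the
-- lowest edge is only a bottom.
heightIncidence : ℕ → ℕ → ℕ
heightIncidence h zero    = χ (0 <ᵇ h)
heightIncidence h (suc k) = χ (suc k <ᵇ h) + χ (k <ᵇ h)

horizontal-incidence : ∀ i h k → incidence horizontalEdges (column i h) (i , i + k) ≡ heightIncidence h k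
horizontal-incidence i h zero    = incidence-column-one horizontalEdges i h (i , i + 0) 0
  (λ j → mk⇔ (to j) (λ { refl → here refl }))
  where
  to : ∀ j → (i , i + 0) ∈ horizontalEdges (i , i + j) → j ≡ 0
  to j (here eq)         = sym (ℕₚ.+-cancelˡ-≡ i 0 j (cong proj₂ eq))
  to j (there (here eq)) = contradiction (trans (sym (ℕₚ.+-identityʳ i)) (cong proj₂ eq)) (ℕₚ.m≢1+m+n i)
horizontal-incidence i h (suc k) = begin
  incidence horizontalEdges (column i h) (i , i + suc k)
    ≡⟨ incidence-column horizontalEdges i h (i , i + suc k) ⟩
  tally (λ j → χ (does ((i , i + suc k) ∈? horizontalEdges (i , i + j)))) h
    ≡⟨ tally-cong h (λ j _ → trans
         (cong χ (does-⇔ (mk⇔ (to j) (from j)) (_ ∈? horizontalEdges (i , i + j)) ((j ℕₚ.≟ suc k) ⊎-dec (j ℕₚ.≟ k))))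
         (χ-∨ j k)) ⟩
  tally (λ j → χ (j ≡ᵇ suc k) + χ (j ≡ᵇ k)) h
    ≡⟨ tally-+ (λ j → χ (j ≡ᵇ suc k)) (λ j → χ (j ≡ᵇ k)) h ⟩
  tally (λ j → χ (j ≡ᵇ suc k)) h + tally (λ j → χ (j ≡ᵇ k)) h
    ≡⟨ cong₂ _+_ (tally-≡ᵇ (suc k) h) (tally-≡ᵇ k h) ⟩
  heightIncidence h (suc k) ∎
  where
  to : ∀ j → (i , i + suc k) ∈ horizontalEdges (i , i + j) → j ≡ suc k ⊎ j ≡ k
  to j (here eq)         = inj₁ (sym (ℕₚ.+-cancelˡ-≡ i _ _ (cong proj₂ eq)))
  to j (there (here eq)) = inj₂ (sym (ℕₚ.suc-injective (ℕₚ.+-cancelˡ-≡ i _ _ (trans (cong proj₂ eq) (sym (ℕₚ.+-suc i j))))))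
  from : ∀ j → j ≡ suc k ⊎ j ≡ k → (i , i + suc k) ∈ horizontalEdges (i , i + j)
  from j (inj₁ refl) = here refl
  from j (inj₂ refl) = there (here (cong (i ,_) (ℕₚ.+-suc i k)))
  -- The two alternatives exclude each other, so their indicators add.
  χ-∨ : ∀ j k → χ ((j ≡ᵇ suc k) ∨ (j ≡ᵇ k)) ≡ χ (j ≡ᵇ suc k) + χ (j ≡ᵇ k)
  χ-∨ zero    k       = refl
  χ-∨ (suc j) (suc k) = χ-∨ j k
  χ-∨ (suc zero)    zero = refl
  χ-∨ (suc (suc j)) zero = refl

-- Horizontal edges are never shared between columns, so each column contributes just two: the
-- bottom of its lowest cell and the top of its highest.
horizontal-ones : ∀ (g : Edge → ℕ) i hs → (∀ c r → i ≤ c → g (c , r) ≡ 0) → All (_≥ 1) hs →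
  ones (λ e → g e + incidence horizontalEdges (columnsFrom i hs) e) (concatMap horizontalEdges (columnsFrom i hs))
  ≡ 2 * length hs
horizontal-ones g i []           g₀ []         = refl
horizontal-ones g i (suc h ∷ hs) g₀ (_ ∷ hs≥1) = begin
  _ ≡⟨ ones-columnsFrom horizontalEdges (λ i k → i , i + k) (λ i k → i , suc (i + k)) (λ _ _ → refl) g i (suc h) hs ⟩
  _ ≡⟨ cong₂ _+_ (cong₂ _+_
         (trans (tally-cong (suc h) (λ k _ → cong isOne (at k))) bottoms)
         (trans (tally-cong (suc h) (λ k _ → cong isOne
           (subst (λ r → weight r ≡ heightIncidence (suc h) (suc k)) (ℕₚ.+-suc i k) (at (suc k))))) tops))
         (horizontal-ones _ (suc i) hs g₀′ hs≥1) ⟩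
  1 + 1 + 2 * length hs  ≡⟨ ℕₚ.*-suc 2 (length hs) ⟨
  2 * suc (length hs)    ∎
  where
  weight : ℕ → ℕ
  weight r = g (i , r) + (incidence horizontalEdges (column i (suc h)) (i , r)
    + incidence horizontalEdges (columnsFrom (suc i) hs) (i , r))
  at : ∀ k → weight (i + k) ≡ heightIncidence (suc h) k
  at k = cong₂ _+_ (g₀ i (i + k) ℕₚ.≤-refl) (trans (cong₂ _+_ (horizontal-incidence i (suc h) k)
    (incidence-columnsFrom horizontalEdges (ℕₚ.≤-reflexive ∘ sym ∘ horizontalEdges-column) (suc i) hs ℕₚ.≤-refl))
    (ℕₚ.+-identityʳ _))
  bottoms : tally (λ k → isOne (heightIncidence (suc h) k)) (suc h) ≡ 1
  -- Above the lowest cell, every bottom edge is shared with the cell below and has weight 2.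
  bottoms = cong suc (trans (tally-cong h (λ k k<h → cong isOne (cong₂ _+_ (χ-< k<h) (χ-< (ℕₚ.m<n⇒m<1+n k<h)))))
    (tally-zero h))
  tops : tally (λ k → isOne (heightIncidence (suc h) (suc k))) (suc h) ≡ 1
  tops = begin
    tally (λ k → isOne (χ (k <ᵇ h) + χ (k <ᵇ suc h))) (suc h)
      ≡⟨ tally-cong (suc h) (λ k k<h → trans (cong (λ n → isOne (χ (k <ᵇ h) + n)) (χ-< k<h)) (isOne-+χ (k <ᵇ h))) ⟩
    tally (λ k → χ (not (k <ᵇ h))) (suc h)  ≡⟨ tally-≮ᵇ h (suc h) ⟩
    suc h ∸ h                               ≡⟨ ℕₚ.m+n∸n≡m 1 h ⟩
    1                                       ∎
  g₀′ : ∀ c r → suc i ≤ c → g (c , r) + incidence horizontalEdges (column i (suc h)) (c , r) ≡ 0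
  g₀′ c r i<c = cong₂ _+_ (g₀ c r (ℕₚ.<⇒≤ i<c))
    (incidence-column-none horizontalEdges i (suc h) (c , r) (λ k e∈ → ℕₚ.<⇒≢ i<c (sym (horizontalEdges-column e∈))))

horizontal-length : ∀ {hs} → IsFibonacci hs → length (boundary horizontalEdges (cells hs)) ≡ 2 * length hs
horizontal-length {hs} fib = horizontal-ones (λ _ → 0) 1 hs (λ _ _ _ → refl) (positive fib)

-- The count

IsFibonacci-irrelevant : ∀ {hs} (p q : IsFibonacci hs) → p ≡ q
IsFibonacci-irrelevant (last p)      (last q)      = cong last (ℕₚ.≤-irrelevant p q)
IsFibonacci-irrelevant (last _)      (_ ∷ ())
IsFibonacci-irrelevant (_ ∷ ())      (last _)
IsFibonacci-irrelevant (p ∷ fib)     (q ∷ fib′)    = cong₂ _∷_ (ℕₚ.≤-irrelevant p q) (IsFibonacci-irrelevant fib fib′)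

heights-injective : ∀ {m n} (P Q : FibonacciPolyomino m n) →
  FibonacciPolyomino.heights P ≡ FibonacciPolyomino.heights Q → P ≡ Q
heights-injective
  record { heights = hs ; isFibonacci = f ; horizontal = h ; vertical = v }
  record { isFibonacci = f′ ; horizontal = h′ ; vertical = v′ } refl
  rewrite IsFibonacci-irrelevant f f′ | ℕₚ.≡-irrelevant h h′ | ℕₚ.≡-irrelevant v v′ = refl

index-∈-lookup : ∀ {A : Set} (xs : List A) i → index (∈-lookup {xs = xs} i) ≡ i
index-∈-lookup (_ ∷ xs) zero    = refl
index-∈-lookup (_ ∷ xs) (suc i) = cong suc (index-∈-lookup xs i)

-- Every first height exceeds 0, so `above` at level 0 lists all sequences. Length and ascent from 0
-- are the two semiperimeters, and a polyomino corresponds to its position in the list.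
polyominoes : ∀ m n → Fin (length (above m n 0)) ↔ FibonacciPolyomino m n
polyominoes m n = mk↔ₛ′ to from to∘from from∘to
  where
  polyomino : ∀ {hs} → hs ∈ above m n 0 → FibonacciPolyomino m n
  polyomino hs∈ with d , n′ , refl , ts , refl , fib , refl , refl ← above-sound m n 0 hs∈ = record
    { heights     = suc (d ℕ.+ 0) ∷ ts
    ; isFibonacci = fib
    ; horizontal  = horizontal-length fib
    ; vertical    = trans (vertical-length fib) (cong (λ h → 2 * (suc h ℕ.+ n′)) (ℕₚ.+-identityʳ d))
    }

  heights-polyomino : ∀ {hs} (hs∈ : hs ∈ above m n 0) → FibonacciPolyomino.heights (polyomino hs∈) ≡ hs
  heights-polyomino hs∈ with d , n′ , refl , ts , refl , fib , refl , refl ← above-sound m n 0 hs∈ = refl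

  member : (P : FibonacciPolyomino m n) → FibonacciPolyomino.heights P ∈ above m n 0
  -- `complete 0` lands in `above`, because `below` at level 0 is empty.
  member P = subst (λ (m , n) → heights ∈ above m n 0) (cong₂ _,_ length≡m ascent≡n) (complete 0 heights isFibonacci)
    where
    open FibonacciPolyomino P
    length≡m : length heights ≡ m
    length≡m = ℕₚ.*-cancelˡ-≡ _ _ 2 (trans (sym (horizontal-length isFibonacci)) horizontal)
    ascent≡n : ascent 0 heights ≡ n
    ascent≡n = ℕₚ.*-cancelˡ-≡ _ _ 2 (trans (sym (vertical-length isFibonacci)) vertical)

  to : Fin (length (above m n 0)) → FibonacciPolyomino m n
  to i = polyomino (∈-lookup {xs = above m n 0} i)

  from : FibonacciPolyomino m n → Fin (length (above m n 0))
  from P = index (member P)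

  to∘from : ∀ P → to (from P) ≡ P
  to∘from P = heights-injective _ P (trans (heights-polyomino (∈-lookup {xs = above m n 0} (from P))) (sym (lookup-index (member P))))

  from∘to : ∀ i → from (to i) ≡ i
  from∘to i = trans (index-irrelevant (heights-polyomino (∈-lookup {xs = above m n 0} i)) (member (to i)))
    (index-∈-lookup (above m n 0) i)
    where
    -- A general `hs` lets the equation be matched with `refl`; the list has no repetitions, so the
    -- two membership proofs then coincide.
    index-irrelevant : ∀ {hs} → hs ≡ lookup (above m n 0) i → (p : hs ∈ above m n 0) → index p ≡ index (∈-lookup {xs = above m n 0} i)
    index-irrelevant refl p = cong index (unique⇒irrelevant (above-unique m n 0) p (∈-lookup i))

-- Coefficients with a zero index are 0 by definition of `generatingFunction`; the lists agree, as
-- `headed` needs a column and `above` a positive ascent.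
generatingFunction-above : generatingFunction (λ m n → length (above m n 0)) ≈ aboveGF 0
generatingFunction-above zero    n       = trans (sym (cong +_ (above-empty n 0))) (above-count 0 n 0)
  where
  above-empty : ∀ n k → length (above 0 n k) ≡ 0
  above-empty zero    k = refl
  above-empty (suc n) k = above-empty n (suc k)
generatingFunction-above (suc m) zero    = above-count (suc m) 0 0
generatingFunction-above (suc m) (suc n) = above-count (suc m) (suc n) 0

theorem2p6 : Σ[ p ∈ (ℕ → ℕ → ℕ) ]
    (∀ m n → m ≥ 1 → n ≥ 1 → Fin (p m n) ↔ FibonacciPolyomino m n) ×
    (Σ[ S ∈ Series ]
    IsSqrtWithConstantTermOne S ((const (+ 1) ⊖ y) ⊛ (const (+ 1) ⊖ y ⊖ const (+ 4) ⊛ x ⊛ y)) ×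
    const (+ 2) ⊛ x ⊛ generatingFunction p ≈ const (+ 1) ⊕ x ⊖ y ⊖ const (+ 3) ⊛ x ⊛ y ⊖ (const (+ 1) ⊕ x) ⊛ S)
theorem2p6 =
  (λ m n → length (above m n 0)) ,
  (λ m n _ _ → polyominoes m n) ,
  root ,
  -- The constant term of `root` computes to 1, which fixes the branch.
  record { square = root-square ; constantTerm = refl } ,
  CommutativeRing.trans seriesRing (CommutativeRing.*-congˡ seriesRing {const (+ 2) ⊛ x} generatingFunction-above) aboveGF-root
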